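{- Let ${\bf u}\in\mathcal A^{\mathbb N}$ have its language closed under reversal. If $D({\bf u})>0$, then either there exists a non-palindromic factor $q$ of ${\bf u}$ such that $\Gamma(q)$ contains a cycle, or there exists a palindromic factor $q$ of ${\bf u}$ such that $\Theta(q)$ contains a cycle. Moreover, if the empty word is the unique factor $q$ with this property, then there exists a letter having a non-palindromic complete return word in ${\bf u}$.
   Context: $\widetilde w$ is the reversal of $w$; $w$ is a palindrome if $w=\widetilde w$; the language is closed under reversal if the reversal of every factor is a factor. Palindromic defect: for a finite word $w$ of length $n$, $D(w)=n+1-$(number of distinct palindromic factors of $w$, including the empty word), and $D({\bf u})=\sup D(w)$ over factors of ${\bf u}$. With $E^+(w)=\{b: wb\text{ factor}\}$, $E^-(w)=\{a: aw\text{ factor}\}$, $E(w)=\{(a,b): awb\text{ factor}\}$: $\Gamma(w)$ is the bipartite graph on $(E^-(w)\times\{ -1\})\cup(E^+(w)\times\{+1\})$ with edges $\{(a,-1),(b,+1)\}$ for $(a,b)\in E(w)$; for palindromic $w$, $\Theta(w)$ is the graph on $E^+(w)$ with edges $\{a,b\}$ for $(a,b)\in E(w)$, $a\ne b$. If $i<j$ are consecutive occurrences of a factor $w$ in ${\bf u}=u_0u_1\cdots$, the word $u_i\cdots u_{j+|w|-1}$ is a complete return word to $w$. -}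

module Defs where

open import Data.List.Base using (List; []; _∷_; _∷ʳ_; length; reverse; applyUpTo; inits; tails; concatMap; filter; deduplicate)
open import Data.List.Properties using (≡-dec)
open import Data.List.Relation.Unary.All using (All)
open import Data.List.Relation.Unary.Linked using (Linked)
open import Data.List.Relation.Unary.Unique.Propositional using (Unique)
open import Data.Nat.Base using (ℕ; suc; _+_; _∸_; _<_; _≤_)
open import Data.Product using (_×_; _,_; ∃; ∃-syntax; proj₁)
open import Data.Sign.Base as Sign using (Sign)
open import Data.Sum.Base using (_⊎_)
open import Level using (0ℓ)
open import Relation.Binary.Core using (Rel)
open import Relation.Binary.Construct.Closure.Symmetric using (SymClosure)
open import Relation.Binary.Definitions using (DecidableEquality)
open import Relation.Binary.PropositionalEquality using (_≡_; _≢_)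
open import Relation.Nullary using (¬_; Dec)
open import Relation.Unary using (Pred)

------------------------------------------------------------------------
-- Finite words

Palindrome : {A : Set} → List A → Set
Palindrome w = w ≡ reverse w

palindrome? : {A : Set} → DecidableEquality A → (w : List A) → Dec (Palindrome w)
palindrome? _≟_ w = ≡-dec _≟_ w (reverse w)

palindromicFactors : {A : Set} → DecidableEquality A → List A → List (List A)
palindromicFactors _≟_ w =
  deduplicate (≡-dec _≟_) (filter (palindrome? _≟_) (concatMap inits (tails w)))

-- A word of length n has at most n + 1 distinct palindromic factors, so the
-- subtraction never truncates.
defect : {A : Set} → DecidableEquality A → List A → ℕ
defect _≟_ w = suc (length w) ∸ length (palindromicFactors _≟_ w)

------------------------------------------------------------------------
-- Suprema in ℕ ∪ {∞}

-- x ∈ ℕ ∪ {∞} is represented by the set of naturals strictly below it, since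
-- the supremum of a family of naturals need not be computable.
ℕ∞ : Set₁
ℕ∞ = Pred ℕ 0ℓ

infix 4 _<∞_
_<∞_ : ℕ → ℕ∞ → Set
m <∞ x = x m

sup : {I : Set} → (I → ℕ) → ℕ∞
sup f m = ∃[ i ] m < f i

------------------------------------------------------------------------
-- Graphs

-- Undirected: {x , y} is an edge as soon as Edge x y or Edge y x holds.
record Graph : Set₁ where
  field
    Carrier : Set
    Vertex  : Pred Carrier 0ℓ
    Edge    : Rel Carrier 0ℓ

  Adjacent : Rel Carrier 0ℓ
  Adjacent = SymClosure Edge

  -- x ∷ xs lists the vertices in cyclic order.  The graphs below are simple,
  -- so a cycle has at least three vertices.
  IsCycle : Carrier → List Carrier → Set
  IsCycle x xs =
      2 ≤ length xs
    × Unique (x ∷ xs)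
    × All Vertex (x ∷ xs)
    × Linked Adjacent (x ∷ (xs ∷ʳ x))

  ContainsCycle : Set
  ContainsCycle = ∃[ x ] ∃[ xs ] IsCycle x xs

open Graph public using (ContainsCycle)

------------------------------------------------------------------------
-- Infinite words

module _ {A : Set} (u : ℕ → A) where

  segment : ℕ → ℕ → List A
  segment i n = applyUpTo (λ k → u (i + k)) n

  OccursAt : List A → ℕ → Set
  OccursAt w i = segment i (length w) ≡ w

  Factor : List A → Set
  Factor w = ∃[ i ] OccursAt w i

  ClosedUnderReversal : Set
  ClosedUnderReversal = ∀ w → Factor w → Factor (reverse w)

  𝔻 : DecidableEquality A → ℕ∞
  𝔻 _≟_ = sup {I = ∃ Factor} (λ w → defect _≟_ (proj₁ w))

  E⁺ : List A → Pred A 0ℓ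
  E⁺ w b = Factor (w ∷ʳ b)

  E⁻ : List A → Pred A 0ℓ
  E⁻ w a = Factor (a ∷ w)

  E : List A → Rel A 0ℓ
  E w a b = Factor (a ∷ (w ∷ʳ b))

  data ΓVertex (w : List A) : Pred (A × Sign) 0ℓ where
    left  : ∀ {a} → E⁻ w a → ΓVertex w (a , Sign.-)
    right : ∀ {b} → E⁺ w b → ΓVertex w (b , Sign.+)

  data ΓEdge (w : List A) : Rel (A × Sign) 0ℓ where
    edge : ∀ {a b} → E w a b → ΓEdge w (a , Sign.-) (b , Sign.+)

  Γ : List A → Graph
  Γ w = record
    { Carrier = A × Sign
    ; Vertex  = ΓVertex w
    ; Edge    = ΓEdge w
    }

  -- Only meaningful for palindromic w.
  Θ : List A → Graph
  Θ w = record
    { Carrier = A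
    ; Vertex  = E⁺ w
    ; Edge    = λ a b → E w a b × a ≢ b
    }

  CyclicFactor : List A → Set
  CyclicFactor q =
      (Factor q × ¬ Palindrome q × ContainsCycle (Γ q))
    ⊎ (Factor q × Palindrome q × ContainsCycle (Θ q))

  ConsecutiveOccurrences : List A → ℕ → ℕ → Set
  ConsecutiveOccurrences w i j =
      i < j
    × OccursAt w i
    × OccursAt w j
    × (∀ k → i < k → k < j → ¬ OccursAt w k)

  CompleteReturnWord : List A → List A → Set
  CompleteReturnWord w v =
    ∃[ i ] ∃[ j ] (ConsecutiveOccurrences w i j × v ≡ segment i ((j + length w) ∸ i))

{-# OPTIONS --safe #-}
module Submission where

-- The Rauzy graph of order n, taken up to reversal, has the classes {x , x̃} of factors of length n as
-- vertices and those of length n + 1 as edges; its loops are the palindromes. A non-palindromic complete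
-- return word v to a palindrome, read from the longest common prefix q of v and ṽ, yields a closed walk of
-- non-palindromic edges that never turns back, of order |q|. Such a walk of order n + 1 runs through the
-- local graphs Γ(w) or Θ(w) with |w| = n, moving from one to the next along edges of order n. Either it
-- closes up inside one local graph, which then has a cycle, or the edges it moves along form a walk of the
-- same kind of order n. This descent must stop, since the edges of order 0 are letters, hence palindromes.
--
-- For the second part, let a, y, …, z be a cycle in Θ(ε), and attach to each position the letter before the
-- next a. If all complete return words to letters are palindromes, this depends only on the letter at that
-- position (unless it is a), so following the cycle from y to z gives y = z.

open import Defs
open import Data.List.Base
  using (List; []; [_]; _∷_; _∷ʳ_; _++_; length; reverse; applyUpTo; applyDownFrom; inits; tails; concatMap)
open import Data.List.Membership.Propositional using (_∈_)
open import Data.List.Membership.Propositional.Properties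
  using (∈-∃++; ∈-++⁻; ∈-++⁺ˡ; ∈-++⁺ʳ; ∈-insert; ∈-map⁺; ∈-concatMap⁺; ∈-filter⁺; ∈-deduplicate⁺)
open import Data.List.Properties
  using (∷-injective; ∷-injectiveˡ; ∷-injectiveʳ; ∷ʳ-injective; ∷ʳ-injectiveˡ; ∷ʳ-injectiveʳ; length-++;
         length-applyUpTo; length-reverse; applyUpTo-∷ʳ; unfold-reverse; reverse-++;
         reverse-involutive; reverse-applyUpTo)
open import Data.List.Relation.Binary.Subset.Propositional using (_⊆_)
open import Data.List.Relation.Unary.All as All using (All; []; _∷_)
open import Data.List.Relation.Unary.All.Properties using (¬Any⇒All¬; ++⁻ˡ)
open import Data.List.Relation.Unary.AllPairs using ([]; _∷_)
open import Data.List.Relation.Unary.Any as Any using (here; there)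
open import Data.List.Relation.Unary.Linked using (Linked; [-]; _∷_)
open import Data.List.Relation.Unary.Unique.Propositional using (Unique)
open import Data.Nat.Base using (ℕ; zero; suc; _+_; _∸_; _≤_; _<_; z≤n; s≤s; z<s; s<s)
open import Data.Nat.Properties
open import Data.Nat.Solver using (module +-*-Solver)
open import Data.Product using (_×_; _,_; ∃; ∃₂; ∃-syntax; proj₁; proj₂)
open import Data.Sign.Base as Sign using (Sign)
open import Data.Sum.Base as Sum using (_⊎_; inj₁; inj₂)
open import Function.Base using (_∘_; case_of_)
open import Level using (0ℓ)
open import Relation.Binary.Construct.Closure.Symmetric using (fwd; bwd; symmetric)
open import Relation.Binary.Definitions using (DecidableEquality; tri<; tri≈; tri>)
open import Relation.Binary.PropositionalEquality
  using (_≡_; _≢_; refl; sym; trans; cong; cong₂; subst; ≢-sym; module ≡-Reasoning)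
open import Relation.Nullary using (¬_; Dec; yes; no; contradiction; _⊎-dec_)
open import Relation.Unary using (Pred; Decidable)

import Data.List.Membership.DecPropositional as DecMembership
import Data.List.Properties as List
import Data.Product.Properties as Product
import Data.Sign.Properties as Sign

private variable
  A : Set

-- Bounded search, sequences and finite words.

least : {P : Pred ℕ 0ℓ} → Decidable P → ∀ n → P n →
        ∃[ m ] (m ≤ n × P m × (∀ {k} → k < m → ¬ P k))
least P? zero    p0 = 0 , z≤n , p0 , λ ()
least {P} P? (suc n) pn with P? 0
... | yes p0 = 0 , z≤n , p0 , λ ()
... | no ¬p0 with least (P? ∘ suc) n pn
...   | m , m≤n , pm , below = suc m , s≤s m≤n , pm , below′
  where
  below′ : ∀ {k} → k < suc m → ¬ P k
  below′ {zero}  _         = ¬p0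
  below′ {suc k} (s<s k<m) = below k<m

greatest : {P : Pred ℕ 0ℓ} → Decidable P → ∀ n →
           (∃[ m ] (m < n × P m × (∀ {k} → m < k → k < n → ¬ P k)))
           ⊎ (∀ {k} → k < n → ¬ P k)
greatest P? zero = inj₂ λ ()
greatest {P} P? (suc n) with P? n
... | yes pn = inj₁ (n , n<1+n n , pn , λ n<k k<1+n → contradiction (≤-<-trans n<k k<1+n) (n≮n _))
... | no ¬pn with greatest P? n
...   | inj₁ (m , m<n , pm , above) = inj₁ (m , m<n⇒m<1+n m<n , pm , between)
  where
  between : ∀ {k} → m < k → k < suc n → ¬ P k
  between m<k k<1+n with m<1+n⇒m<n∨m≡n k<1+n
  ... | inj₁ k<n  = above m<k k<n
  ... | inj₂ refl = ¬pn
...   | inj₂ none = inj₂ below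
  where
  below : ∀ {k} → k < suc n → ¬ P k
  below k<1+n with m<1+n⇒m<n∨m≡n k<1+n
  ... | inj₁ k<n  = none k<n
  ... | inj₂ refl = ¬pn

applyUpTo-cong⁺ : {f g : ℕ → A} → ∀ n → (∀ {k} → k < n → f k ≡ g k) → applyUpTo f n ≡ applyUpTo g n
applyUpTo-cong⁺ zero    f≗g = refl
applyUpTo-cong⁺ (suc n) f≗g = cong₂ _∷_ (f≗g z<s) (applyUpTo-cong⁺ n (f≗g ∘ s<s))

applyUpTo-cong⁻ : {f g : ℕ → A} → ∀ n → applyUpTo f n ≡ applyUpTo g n → ∀ {k} → k < n → f k ≡ g k
applyUpTo-cong⁻ (suc n) eq {zero}  _         = ∷-injectiveˡ eq
applyUpTo-cong⁻ (suc n) eq {suc k} (s<s k<n) = applyUpTo-cong⁻ n (∷-injectiveʳ eq) k<n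

applyUpTo-+ : (f : ℕ → A) → ∀ m n → applyUpTo f (m + n) ≡ applyUpTo f m ++ applyUpTo (λ k → f (m + k)) n
applyUpTo-+ f zero    n = refl
applyUpTo-+ f (suc m) n = cong (f 0 ∷_) (applyUpTo-+ (f ∘ suc) m n)

-- Pairs positions counted from opposite ends; the equation on `k` and `l` stands in for a truncated
-- subtraction.
Mirrored : (f g : ℕ → A) → ℕ → Set
Mirrored f g n = ∀ k l → suc (k + l) ≡ n → f k ≡ g l

applyUpTo-mirror⁻ : {f g : ℕ → A} → ∀ n → applyUpTo f n ≡ reverse (applyUpTo g n) → Mirrored f g n
applyUpTo-mirror⁻ {g = g} n eq = go n (trans eq (reverse-applyUpTo g n))
  where
  go : ∀ {f} n → applyUpTo f n ≡ applyDownFrom g n → Mirrored f g n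
  go (suc n) eq zero    l refl = ∷-injectiveˡ eq
  go (suc n) eq (suc k) l e    = go n (∷-injectiveʳ eq) k l (suc-injective e)

reverse-flip : {x y : List A} → x ≡ reverse y → y ≡ reverse x
reverse-flip {y = y} eq = trans (sym (reverse-involutive y)) (cong reverse (sym eq))

reverse-∷-∷ʳ : ∀ (a : A) w b → reverse (a ∷ (w ∷ʳ b)) ≡ b ∷ (reverse w ∷ʳ a)
reverse-∷-∷ʳ a w b = trans (unfold-reverse a (w ∷ʳ b)) (cong (_∷ʳ a) (reverse-++ w [ b ]))

∷ʳ-view : ∀ {n} (x : List A) → length x ≡ suc n → ∃₂ λ w b → x ≡ w ∷ʳ b × length w ≡ n
∷ʳ-view (a ∷ [])     refl = [] , a , refl , refl
∷ʳ-view (a ∷ c ∷ x)  refl with ∷ʳ-view (c ∷ x) refl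
... | w , b , eq , len = a ∷ w , b , cong (a ∷_) eq , cong suc len

∷-∷ʳ-view : ∀ {n} (x : List A) → length x ≡ suc (suc n) →
            ∃[ a ] ∃[ w ] ∃[ b ] (x ≡ a ∷ (w ∷ʳ b) × length w ≡ n)
∷-∷ʳ-view (a ∷ x) len with ∷ʳ-view x (suc-injective len)
... | w , b , refl , len′ = a , w , b , refl , len′

-- Comparing letters one place apart shows that `b` and every letter of `w` equal `a`; this is why
-- `w`, a power of `a`, is a palindrome.
∷ʳ≡∷⇒power : ∀ w {a b : A} → w ∷ʳ b ≡ a ∷ w → b ≡ a × Palindrome w
∷ʳ≡∷⇒power []      refl = refl , refl
∷ʳ≡∷⇒power (x ∷ w) {a} eq with ∷-injective eq
... | refl , eq′ with ∷ʳ≡∷⇒power w eq′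
...   | refl , pal = refl , trans (sym eq′) (trans (cong (_∷ʳ a) pal) (sym (unfold-reverse a w)))

-- The first letter of a nonempty `w` is `a`, and it is also the last letter of `reverse w`, hence
-- equal to `b`.
∷ʳ≡∷-reverse⇒≡ : ∀ w {a b : A} → w ∷ʳ b ≡ a ∷ reverse w → b ≡ a
∷ʳ≡∷-reverse⇒≡ []      refl = refl
∷ʳ≡∷-reverse⇒≡ (x ∷ w) {a} {b} eq with ∷-injective eq
... | refl , eq′ = ∷ʳ-injectiveʳ w (reverse w) (trans eq′ (unfold-reverse x w))

Unique-⊆⇒length≤ : {xs ys : List A} → Unique xs → xs ⊆ ys → length xs ≤ length ys
Unique-⊆⇒length≤ [] _ = z≤n
Unique-⊆⇒length≤ {xs = x ∷ xs} (x# ∷ un) xs⊆ys with ∈-∃++ (xs⊆ys (here refl))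
... | ys₁ , ys₂ , refl = begin
  suc (length xs)                 ≤⟨ s≤s (Unique-⊆⇒length≤ un xs⊆) ⟩
  suc (length (ys₁ ++ ys₂))       ≡⟨ cong suc (length-++ ys₁) ⟩
  suc (length ys₁ + length ys₂)   ≡⟨ +-suc (length ys₁) (length ys₂) ⟨
  length ys₁ + suc (length ys₂)   ≡⟨ length-++ ys₁ ⟨
  length (ys₁ ++ x ∷ ys₂)         ∎
  where
  open ≤-Reasoning
  xs⊆ : xs ⊆ ys₁ ++ ys₂
  xs⊆ z∈ with ∈-++⁻ ys₁ (xs⊆ys (there z∈))
  ... | inj₁ z∈₁         = ∈-++⁺ˡ z∈₁
  ... | inj₂ (here refl) = contradiction refl (All.lookup x# z∈)
  ... | inj₂ (there z∈₂) = ∈-++⁺ʳ ys₁ z∈₂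

Unique-cycle : ∀ ps {x : A} {qs} → Unique (ps ++ x ∷ qs) → Unique (x ∷ ps)
Unique-cycle []       un = [] ∷ []
Unique-cycle (p ∷ ps) (p# ∷ un) with Unique-cycle ps un
... | x# ∷ un′ = (≢-sym (All.lookup p# (∈-insert ps)) ∷ x#) ∷ (++⁻ˡ ps p# ∷ un′)

Linked-cut : ∀ ps {x : A} {qs} {R : A → A → Set} → Linked R (ps ++ x ∷ qs) → Linked R (ps ∷ʳ x)
Linked-cut []           l       = [-]
Linked-cut (p ∷ [])     (r ∷ l) = r ∷ [-]
Linked-cut (p ∷ q ∷ ps) (r ∷ l) = r ∷ Linked-cut (q ∷ ps) l

prefix∈inits : (xs ys : List A) → xs ∈ inits (xs ++ ys)
prefix∈inits []       ys = here refl
prefix∈inits (x ∷ xs) ys = there (∈-map⁺ (x ∷_) (prefix∈inits xs ys))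

suffix∈tails : (xs ys : List A) → ys ∈ tails (xs ++ ys)
suffix∈tails []       ys = here refl
suffix∈tails (x ∷ xs) ys = there (suffix∈tails xs ys)

infix∈ : (xs ys zs : List A) → ys ∈ concatMap inits (tails (xs ++ ys ++ zs))
infix∈ xs ys zs = ∈-concatMap⁺ inits (Any.map (λ { refl → prefix∈inits ys zs }) (suffix∈tails xs (ys ++ zs)))

-- Words up to reversal.

infix 4 _≃_

_≃_ : List A → List A → Set
x ≃ y = x ≡ y ⊎ x ≡ reverse y

≃-sym : {x y : List A} → x ≃ y → y ≃ x
≃-sym (inj₁ eq) = inj₁ (sym eq)
≃-sym (inj₂ eq) = inj₂ (reverse-flip eq)

≃-trans : {x y z : List A} → x ≃ y → y ≃ z → x ≃ z
≃-trans (inj₁ refl) y≃z         = y≃z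
≃-trans (inj₂ x≡)   (inj₁ refl) = inj₂ x≡
≃-trans {z = z} (inj₂ x≡) (inj₂ y≡) = inj₁ (trans x≡ (trans (cong reverse y≡) (reverse-involutive z)))

-- Reduced walks and cycles in a loopless graph

module ReducedWalk (G : Graph) (_≟_ : DecidableEquality (Graph.Carrier G)) where
  open Graph G hiding (ContainsCycle)

  module _ (irrefl : ∀ {x y} → Adjacent x y → x ≢ y)
           (vertexˡ : ∀ {x y} → Adjacent x y → Vertex x)
           (vertexʳ : ∀ {x y} → Adjacent x y → Vertex y) where

    -- Walk x y z leads from x to z, with y next after x, and never turns back.
    data Walk : Carrier → Carrier → Carrier → Set where
      one  : ∀ {x y} → Adjacent x y → Walk x y y
      cons : ∀ {x y z t} → Adjacent x y → x ≢ z → Walk y z t → Walk x y t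

    -- The path is built from the end of the walk. A new start `x` either prolongs it or already
    -- lies on it. With no loop and no turning back, `x` then lies beyond `z`, and the stretch up to
    -- it closes a cycle of at least three vertices.
    walk⇒path : ∀ {x y t} → Walk x y t → ContainsCycle G ⊎
      (∃[ zs ] (t ∈ y ∷ zs × Linked Adjacent (x ∷ y ∷ zs) × Unique (x ∷ y ∷ zs) × All Vertex (x ∷ y ∷ zs)))
    walk⇒path (one adj) = inj₂ ([] , here refl , adj ∷ [-] , (irrefl adj ∷ []) ∷ [] ∷ [] ,
                                vertexˡ adj ∷ vertexʳ adj ∷ [])
    walk⇒path {x} {y} (cons {z = z} adj x≢z w) with walk⇒path w
    ... | inj₁ cycle = inj₁ cycle
    ... | inj₂ (zs , t∈ , linked , un , vs) with x ∈? (y ∷ z ∷ zs)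
      where open DecMembership _≟_ using (_∈?_)
    ...   | no x∉ = inj₂ (z ∷ zs , there t∈ , adj ∷ linked , ¬Any⇒All¬ _ x∉ ∷ un , vertexˡ adj ∷ vs)
    ...   | yes (here refl) = contradiction refl (irrefl adj)
    ...   | yes (there (here refl)) = contradiction refl x≢z
    ...   | yes (there (there x∈)) with ∈-∃++ x∈
    ...     | ps , qs , refl = inj₁ (x , y ∷ z ∷ ps , s≤s (s≤s z≤n) , Unique-cycle (y ∷ z ∷ ps) un ,
                                     vertexˡ adj ∷ ++⁻ˡ (y ∷ z ∷ ps) vs , adj ∷ Linked-cut (y ∷ z ∷ ps) linked)

    closedWalk⇒cycle : ∀ {x y} → Walk x y x → ContainsCycle G
    closedWalk⇒cycle w with walk⇒path w
    ... | inj₁ cycle = cycle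
    ... | inj₂ (_ , x∈ , _ , x# ∷ _ , _) = contradiction refl (All.lookup x# x∈)

-- Rauzy graphs up to reversal: a word f is an edge from its prefix to its suffix of length |f| - 1,
-- reverse f is the same edge run backwards, and the loops are the palindromes.
Source Target : List A → List A → Set
Source f s = ∃[ b ] f ≡ s ∷ʳ b
Target f t = ∃[ a ] f ≡ a ∷ t

Join : List A → List A → Set
Join f g = ∃₂ λ t s → Target f t × Source g s × t ≃ s

Source⇒Target-reverse : {f s : List A} → Source f s → Target (reverse f) (reverse s)
Source⇒Target-reverse {s = s} (b , refl) = b , reverse-++ s [ b ]

Source-unique : {f s s′ : List A} → Source f s → Source f s′ → s ≡ s′
Source-unique {s = s} {s′} (_ , refl) (_ , eq) = ∷ʳ-injectiveˡ s s′ eq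

Target-unique : {f t t′ : List A} → Target f t → Target f t′ → t ≡ t′
Target-unique (_ , refl) (_ , refl) = refl

data Trail (P : List A → Set) : List A → List A → Set where
  single : ∀ {f} → P f → Trail P f f
  _∷⟨_⟩_ : ∀ {f f′ g} → P f → Join f f′ × f′ ≢ reverse f → Trail P f′ g → Trail P f g

Trail-map : {P Q : List A → Set} → (∀ {f} → P f → Q f) → ∀ {f g} → Trail P f g → Trail Q f g
Trail-map P⇒Q (single p)     = single (P⇒Q p)
Trail-map P⇒Q (p ∷⟨ st ⟩ tr) = P⇒Q p ∷⟨ st ⟩ Trail-map P⇒Q tr

Trail-head : {P : List A → Set} → ∀ {f g} → Trail P f g → P f
Trail-head (single p)   = p
Trail-head (p ∷⟨ _ ⟩ _) = p

-- Local graphs of an infinite word closed under reversal.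

module Rauzy {A : Set} (_≟_ : DecidableEquality A) (u : ℕ → A) (closed : ClosedUnderReversal u) where

  _≟ʷ_ : DecidableEquality (List A)
  _≟ʷ_ = List.≡-dec _≟_

  _≃?_ : (x y : List A) → Dec (x ≃ y)
  x ≃? y = (x ≟ʷ y) ⊎-dec (x ≟ʷ reverse y)

  factor-tail : ∀ {a x} → Factor u (a ∷ x) → Factor u x
  factor-tail {x = x} (i , eq) = suc i ,
    trans (applyUpTo-cong⁺ (length x) λ {k} _ → cong u (sym (+-suc i k))) (∷-injectiveʳ eq)

  factor-reverse⁻ : ∀ {x} → Factor u (reverse x) → Factor u x
  factor-reverse⁻ {x} f = subst (Factor u) (reverse-involutive x) (closed _ f)

  factor-init : ∀ {x b} → Factor u (x ∷ʳ b) → Factor u x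
  factor-init {x} {b} f = factor-reverse⁻ (factor-tail (subst (Factor u) (reverse-++ x [ b ]) (closed _ f)))

  factor-flip : ∀ {a w b} → Factor u (a ∷ (w ∷ʳ b)) → Factor u (b ∷ (reverse w ∷ʳ a))
  factor-flip {a} {w} {b} f = subst (Factor u) (reverse-∷-∷ʳ a w b) (closed _ f)

  -- Edges a w b, b w̃ d, d w …, all through the vertex {w , w̃}; the last one is x z y with z ∈ {w , w̃}.
  data Turning : (w : List A) (a b : A) (z : List A) (y : A) → Set where
    one  : ∀ {w a b} → Factor u (a ∷ (w ∷ʳ b)) → ¬ Palindrome (a ∷ (w ∷ʳ b)) → Turning w a b w b
    turn : ∀ {w a b d z y} → Factor u (a ∷ (w ∷ʳ b)) → ¬ Palindrome (a ∷ (w ∷ʳ b)) → d ≢ a →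
           Turning (reverse w) b d z y → Turning w a b z y

  Turning-factor : ∀ {w a b z y} → Turning w a b z y → Factor u w
  Turning-factor (one f _)      = factor-init (factor-tail f)
  Turning-factor (turn f _ _ _) = factor-init (factor-tail f)

  Turning-≃ : ∀ {w a b z y} → Turning w a b z y → z ≃ w
  Turning-≃ (one _ _)          = inj₁ refl
  Turning-≃ {w} (turn _ _ _ t) = ≃-trans (Turning-≃ t) (inj₂ refl)

  module _ {w : List A} (pal : Palindrome w) where

    private
      endpoints : ∀ {a b} → E u w a b → E⁺ u w a × E⁺ u w b
      endpoints f = subst (λ x → Factor u (x ∷ʳ _)) (sym pal) (factor-tail (factor-flip f)) , factor-tail f

      irrefl : ∀ {a b} → Graph.Adjacent (Θ u w) a b → a ≢ b
      irrefl (fwd (_ , a≢b)) = a≢b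
      irrefl (bwd (_ , b≢a)) = ≢-sym b≢a

      vertexˡ : ∀ {a b} → Graph.Adjacent (Θ u w) a b → E⁺ u w a
      vertexˡ (fwd (f , _)) = proj₁ (endpoints f)
      vertexˡ (bwd (f , _)) = proj₂ (endpoints f)

      vertexʳ : ∀ {a b} → Graph.Adjacent (Θ u w) a b → E⁺ u w b
      vertexʳ (fwd (f , _)) = proj₂ (endpoints f)
      vertexʳ (bwd (f , _)) = proj₁ (endpoints f)

      open ReducedWalk (Θ u w) _≟_

      adjacent : ∀ {a b} → Factor u (a ∷ (w ∷ʳ b)) → ¬ Palindrome (a ∷ (w ∷ʳ b)) → Graph.Adjacent (Θ u w) a b
      -- Since `w` is a palindrome, equal end letters would make the whole edge a palindrome.
      adjacent {a} {b} f ¬pal = fwd (f , λ { refl →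
        ¬pal (sym (trans (reverse-∷-∷ʳ a w b) (cong (λ x → a ∷ (x ∷ʳ b)) (sym pal)))) })

      walk : ∀ {w′ a b z y} → w′ ≡ w → Turning w′ a b z y → Walk irrefl vertexˡ vertexʳ a b y
      walk refl (one f ¬pal)        = one (adjacent f ¬pal)
      walk refl (turn f ¬pal d≢a t) = cons (adjacent f ¬pal) (≢-sym d≢a) (walk (sym pal) t)

    closedTurning⇒Θ-cycle : ∀ {a b z} → Turning w a b z a → ContainsCycle (Θ u w)
    closedTurning⇒Θ-cycle t = closedWalk⇒cycle irrefl vertexˡ vertexʳ (walk refl t)

  module _ {w : List A} where

    private
      irrefl : ∀ {p q} → Graph.Adjacent (Γ u w) p q → p ≢ q
      irrefl (fwd (edge _)) ()
      irrefl (bwd (edge _)) ()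

      vertexˡ : ∀ {p q} → Graph.Adjacent (Γ u w) p q → ΓVertex u w p
      vertexˡ (fwd (edge f)) = left (factor-init f)
      vertexˡ (bwd (edge f)) = right (factor-tail f)

      vertexʳ : ∀ {p q} → Graph.Adjacent (Γ u w) p q → ΓVertex u w q
      vertexʳ (fwd (edge f)) = right (factor-tail f)
      vertexʳ (bwd (edge f)) = left (factor-init f)

      open ReducedWalk (Γ u w) (Product.≡-dec _≟_ Sign._≟_)

      -- The sign records the direction in which `w` is read: edges through `w` start on the left
      -- side of the bipartite graph, edges through `reverse w` on the right side, and each turn
      -- flips the direction.
      orient : Sign → List A
      orient Sign.- = w
      orient Sign.+ = reverse w

      adjacent : ∀ s {a b} → Factor u (a ∷ (orient s ∷ʳ b)) →
                 Graph.Adjacent (Γ u w) (a , s) (b , Sign.opposite s)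
      adjacent Sign.- f = fwd (edge f)
      adjacent Sign.+ f = bwd (edge (subst (λ x → Factor u (_ ∷ (x ∷ʳ _))) (reverse-involutive w) (factor-flip f)))

      reverse-orient : ∀ s → reverse (orient s) ≡ orient (Sign.opposite s)
      reverse-orient Sign.- = refl
      reverse-orient Sign.+ = reverse-involutive w

      walk : ∀ s {w′ a b z y} → w′ ≡ orient s → Turning w′ a b z y →
             ∃[ s′ ] (z ≡ orient s′ × Walk irrefl vertexˡ vertexʳ (a , s) (b , Sign.opposite s) (y , Sign.opposite s′))
      walk s refl (one f _) = s , refl , one (adjacent s f)
      walk s refl (turn f _ d≢a t) with walk (Sign.opposite s) (reverse-orient s) t
      ... | s′ , z≡ , wk = s′ , z≡ , cons (adjacent s f) (λ eq → d≢a (sym (cong proj₁ eq))) wk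

    -- Because the last edge is read through `reverse w`, the walk ends on the left side, at the
    -- very vertex where it began.
    closedTurning⇒Γ-cycle : ∀ {a b} → ¬ Palindrome w → Turning w a b (reverse w) a → ContainsCycle (Γ u w)
    closedTurning⇒Γ-cycle ¬pal t with walk Sign.- refl t
    ... | Sign.- , z≡ , _  = contradiction (sym z≡) ¬pal
    ... | Sign.+ , _  , wk = closedWalk⇒cycle irrefl vertexˡ vertexʳ wk

  closedTurning⇒cyclic : ∀ {w a b} → Turning w a b (reverse w) a → ∃ (CyclicFactor u)
  closedTurning⇒cyclic {w} t with palindrome? _≟_ w
  ... | yes pal = w , inj₂ (Turning-factor t , pal , closedTurning⇒Θ-cycle pal t)
  ... | no ¬pal = w , inj₁ (Turning-factor t , ¬pal , closedTurning⇒Γ-cycle ¬pal t)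

  -- Descent of closed trails from order n + 1 to order n.

  Good : ℕ → List A → Set
  Good n f = Factor u f × ¬ Palindrome f × length f ≡ suc n

  -- If `a ∷ w` were a palindrome, dropping its last letter would give `z ≡ reverse w`: a crossing
  -- between different classes is not along a loop.
  crossing-good : ∀ {n a w b z y} → Good (suc n) (a ∷ (w ∷ʳ b)) → z ∷ʳ y ≡ a ∷ w → ¬ z ≃ w → Good n (a ∷ w)
  crossing-good {n} {a} {w} {b} {z} {y} (f , _ , len) eq z≄w =
    factor-init f ,
    (λ pal → z≄w (inj₂ (∷ʳ-injectiveˡ z (reverse w) (trans eq (trans pal (unfold-reverse a w)))))) ,
    suc-injective (trans (cong suc (trans (+-comm 1 (length w)) (sym (length-++ w)))) len)

  -- The second edge either turns around the class of `z` or lies around another class, reached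
  -- along the lower edge `z ∷ʳ y`. When `z ≃ w`, the apparent crossing `z ∷ʳ y ≡ a ∷ w` is itself a
  -- turn, by the two lemmas on overlapping words.
  join-view : ∀ {x z y a w b} → Join (x ∷ (z ∷ʳ y)) (a ∷ (w ∷ʳ b)) →
              (a ≡ y × w ≡ reverse z) ⊎ (z ∷ʳ y ≡ a ∷ w × ¬ z ≃ w)
  join-view {x} {z} {y} {a} {w} {b} (t , s , tgt , src , t≃s)
    with Target-unique tgt (x , refl) | Source-unique {s′ = a ∷ w} src (b , refl)
  ... | refl | refl = case t≃s of λ where
      (inj₁ eq) → case z ≃? w of λ where
        (no z≄w)          → inj₂ (eq , z≄w)
        (yes (inj₁ refl)) → let y≡a , pal = ∷ʳ≡∷⇒power z eq in inj₁ (sym y≡a , pal)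
        (yes (inj₂ z≡))   → let w≡ = reverse-flip z≡ in
          inj₁ (sym (∷ʳ≡∷-reverse⇒≡ z (trans eq (cong (a ∷_) w≡))) , w≡)
      (inj₂ eq) → let z≡ , y≡a = ∷ʳ-injective z (reverse w) (trans eq (unfold-reverse a w)) in
        inj₁ (sym y≡a , reverse-flip z≡)

  -- How a trail that starts with the edge a w b and ends with an edge x z y looks one level below.
  data Descent (n : ℕ) (w : List A) (a b : A) (z : List A) (y : A) : Set where
    stay  : Turning w a b z y → Descent n w a b z y
    leave : ∀ {z′ y′ c w″} → Turning w a b z′ y′ → Trail (Good n) (z′ ∷ʳ y′) (c ∷ w″) → w″ ≃ z →
            Descent n w a b z y

  -- The lower trail arrives at `w` along `a ∷ w`, turns there, and departs along `z′ ∷ʳ y′`. It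
  -- turns back only if the departing edge is `reverse (a ∷ w)`, and then the turning is closed and
  -- yields a cycle.
  cross : ∀ {n a w b z′ y′ g} → Good n (a ∷ w) → Turning w a b z′ y′ → Trail (Good n) (z′ ∷ʳ y′) g →
          ∃ (CyclicFactor u) ⊎ Trail (Good n) (a ∷ w) g
  cross {a = a} {w} {z′ = z′} {y′} good t tr with z′ ≟ʷ reverse w | y′ ≟ a
  ... | yes refl | yes refl = inj₁ (closedTurning⇒cyclic t)
  ... | no z≢    | _        = inj₂ (good ∷⟨ (w , z′ , (a , refl) , (y′ , refl) , ≃-sym (Turning-≃ t)) ,
    (λ eq → z≢ (∷ʳ-injectiveˡ z′ (reverse w) (trans eq (unfold-reverse a w)))) ⟩ tr)
  ... | _        | no y≢    = inj₂ (good ∷⟨ (w , z′ , (a , refl) , (y′ , refl) , ≃-sym (Turning-≃ t)) ,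
    (λ eq → y≢ (∷ʳ-injectiveʳ z′ (reverse w) (trans eq (unfold-reverse a w)))) ⟩ tr)

  -- Works back from the end of the trail: a turning joint lengthens the first turning, while a
  -- crossing joint starts a new one and adds the crossed edge to the lower trail.
  descend : ∀ {n a w b g} → Trail (Good (suc n)) (a ∷ (w ∷ʳ b)) g →
            ∃ (CyclicFactor u) ⊎ (∃[ x ] ∃[ z ] ∃[ y ] (g ≡ x ∷ (z ∷ʳ y) × Descent n w a b z y))
  descend {a = a} {w} {b} (single (f , ¬pal , _)) = inj₂ (a , w , b , refl , stay (one f ¬pal))
  descend {n} {a} {w} {b} (_∷⟨_⟩_ {f′ = f′} (f , ¬pal , _) (join , f′≢) tr)
    with ∷-∷ʳ-view f′ (proj₂ (proj₂ (Trail-head tr)))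
  ... | a′ , w′ , b′ , refl , _ with descend tr
  ...   | inj₁ cyc = inj₁ cyc
  ...   | inj₂ (x , z , y , refl , d) with join-view join
  ...     | inj₁ (refl , refl) = inj₂ (x , z , y , refl , extend d)
    where
    b′≢a : b′ ≢ a
    b′≢a refl = f′≢ (sym (reverse-∷-∷ʳ a w b))
    extend : Descent n (reverse w) b b′ z y → Descent n w a b z y
    extend (stay t)         = stay (turn f ¬pal b′≢a t)
    extend (leave t tr w≃z) = leave (turn f ¬pal b′≢a t) tr w≃z
  ...     | inj₂ (eq , w≄w′) with crossing-good (Trail-head tr) eq w≄w′ | d
  ...       | good | stay t = inj₂ (x , z , y , refl ,
    leave (one f ¬pal) (subst (λ e → Trail (Good n) e (a′ ∷ w′)) (sym eq) (single good)) (≃-sym (Turning-≃ t)))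
  ...       | good | leave {c = c} {w″} t tr′ w″≃z with cross good t tr′
  ...         | inj₁ cyc = inj₁ cyc
  ...         | inj₂ tr″ = inj₂ (x , z , y , refl ,
    leave (one f ¬pal) (subst (λ e → Trail (Good n) e (c ∷ w″)) (sym eq) tr″) w″≃z)

  -- The joint from `g` to `f` is allowed to turn back, so the lower trail may be closed wherever
  -- the descent cuts it. If all joints are turns, the trail is a closed turning around one class.
  closedTrail⇒cyclic : ∀ n {f g} → Trail (Good n) f g → Join g f → ∃ (CyclicFactor u)
  closedTrail⇒cyclic zero {a ∷ []} tr _ = contradiction refl (proj₁ (proj₂ (Trail-head tr)))
  closedTrail⇒cyclic zero {[]} tr _ = contradiction refl (proj₁ (proj₂ (Trail-head tr)))
  closedTrail⇒cyclic zero {_ ∷ _ ∷ _} tr _ = case proj₂ (proj₂ (Trail-head tr)) of λ ()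
  closedTrail⇒cyclic (suc n) {f} tr join with ∷-∷ʳ-view f (proj₂ (proj₂ (Trail-head tr)))
  ... | a , w , b , refl , _ with descend tr
  ...   | inj₁ cyc = cyc
  ...   | inj₂ (x , z , y , refl , d) with join-view join | d
  ...     | inj₁ (refl , refl) | stay t =
    closedTurning⇒cyclic (subst (λ v → Turning w a b v a) (sym (reverse-involutive z)) t)
  ...     | inj₂ (_ , z≄w)     | stay t = contradiction (Turning-≃ t) z≄w
  -- All crossings lie inside the trail, and both ends of the lower trail meet in the class of `w`.
  ...     | inj₁ (_ , w≡)      | leave {z′} {y′} {c} {w″} t tr′ w″≃z =
    closedTrail⇒cyclic n tr′ (w″ , z′ , (c , refl) , (y′ , refl) ,
      ≃-trans w″≃z (≃-sym (≃-trans (Turning-≃ t) (inj₂ w≡))))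
  -- The closing joint crosses as well, and its edge `a ∷ w` is put in front of the lower trail.
  ...     | inj₂ (eq , z≄w)    | leave {c = c} {w″} t tr′ w″≃z with cross (crossing-good (Trail-head tr) eq z≄w) t tr′
  ...       | inj₁ cyc = cyc
  ...       | inj₂ tr″ = closedTrail⇒cyclic n tr″ (w″ , z , (c , refl) , (y , sym eq) , w″≃z)

  -- From a non-palindromic complete return word to a closed trail

  -- A freely reduced walk, possibly empty, from the vertex s to the vertex end.
  Reduced : (P : List A → Set) → List A → List A → Set
  Reduced P s end = s ≃ end
    ⊎ (∃₂ λ f g → Trail P f g × (∃[ s′ ] (Source f s′ × s ≃ s′)) × (∃[ t ] (Target g t × t ≃ end)))

  Reduced-resp : ∀ {P s t end} → s ≃ t → Reduced P t end → Reduced P s end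
  Reduced-resp s≃t (inj₁ t≃end) = inj₁ (≃-trans s≃t t≃end)
  Reduced-resp s≃t (inj₂ (f , g , tr , (s′ , src , t≃s′) , end)) =
    inj₂ (f , g , tr , (s′ , src , ≃-trans s≃t t≃s′) , end)

  -- A palindromic edge is a loop and is dropped; an edge followed by its own reverse cancels with
  -- it; any other edge is put in front.
  reduce : ∀ {P f s t end} → (¬ Palindrome f → P f) → Source f s → Target f t → Reduced P t end → Reduced P s end
  reduce {f = f} {s} {t} Pf src tgt red with palindrome? _≟_ f
  ... | yes pal = Reduced-resp (inj₂ (reverse-flip t≡)) red
    where
    t≡ : t ≡ reverse s
    t≡ = Target-unique (subst (λ x → Target x t) pal tgt) (Source⇒Target-reverse src)
  reduce {f = f} {s} {t} Pf src tgt (inj₁ t≃end) | no ¬pal =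
    inj₂ (f , f , single (Pf ¬pal) , (s , src , inj₁ refl) , (t , tgt , t≃end))
  reduce {f = f} {s} {t} Pf src tgt (inj₂ (e , g , tr , (s′ , src′ , t≃s′) , end)) | no ¬pal with e ≟ʷ reverse f
  ... | no e≢ = inj₂ (f , g , Pf ¬pal ∷⟨ (t , s′ , tgt , src′ , t≃s′) , e≢ ⟩ tr , (s , src , inj₁ refl) , end)
  ... | yes refl with tr | end
  ...   | single _ | t′ , tgt′ , t′≃end =
    inj₁ (≃-trans (inj₂ (reverse-flip (Target-unique tgt′ (Source⇒Target-reverse src)))) t′≃end)
  ...   | _ ∷⟨ (t₁ , s₁ , tgt₁ , src₁ , t₁≃s₁) , _ ⟩ tr′ | end′ =
    inj₂ (_ , g , tr′ , (s₁ , src₁ , ≃-trans (inj₂ (reverse-flip t₁≡)) t₁≃s₁) , end′)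
    where t₁≡ = Target-unique tgt₁ (Source⇒Target-reverse src)

  segment-source : ∀ j n → Source (segment u j (suc n)) (segment u j n)
  segment-source j n = u (j + n) , sym (applyUpTo-∷ʳ (λ k → u (j + k)) n)

  segment-target : ∀ j n → Target (segment u j (suc n)) (segment u (suc j) n)
  segment-target j n = u (j + 0) , cong (u (j + 0) ∷_) (applyUpTo-cong⁺ n λ {k} _ → cong u (+-suc j k))

  length-segment : ∀ j n → length (segment u j n) ≡ n
  length-segment j n = length-applyUpTo (λ k → u (j + k)) n

  segment-factor : ∀ j n → Factor u (segment u j n)
  segment-factor j n = j , cong (segment u j) (length-segment j n)

  segment-≡⁻ : ∀ {i j} n → segment u i n ≡ segment u j n → ∀ {k} → k < n → u (i + k) ≡ u (j + k)
  segment-≡⁻ {i} {j} = applyUpTo-cong⁻ {f = λ k → u (i + k)} {g = λ k → u (j + k)}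

  segment-mirror⁻ : ∀ {i j} n → segment u i n ≡ reverse (segment u j n) →
                    ∀ k l → suc (k + l) ≡ n → u (i + k) ≡ u (j + l)
  segment-mirror⁻ {i} {j} = applyUpTo-mirror⁻ {f = λ k → u (i + k)} {g = λ k → u (j + k)}

  record NonPalindromicReturn : Set where
    field
      {i d m}  : ℕ
      0<d      : 0 < d
      pal      : Palindrome (segment u i m)
      again    : segment u (d + i) m ≡ segment u i m
      between  : ∀ {t} → 0 < t → t < d → segment u (t + i) m ≢ segment u i m
      ¬pal     : ¬ Palindrome (segment u i (d + m))

  module _ (ret : NonPalindromicReturn) where
    open NonPalindromicReturn ret

    private
      -- Compares the prefixes of length `s + m` of the return word and of its reversal for growing
      -- `s`. They agree at `s = 0`, both being the returned palindrome, and agreement up to `s = d`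
      -- would make the return word a palindrome.
      mismatch : ∀ s k → s + k ≡ d → segment u i (s + m) ≡ reverse (segment u (k + i) (s + m)) →
        ∃₂ λ s k → s + suc k ≡ d × segment u i (s + m) ≡ reverse (segment u (suc k + i) (s + m))
                 × segment u i (suc (s + m)) ≢ reverse (segment u (k + i) (suc (s + m)))
      mismatch s zero s+0≡d eq rewrite trans (sym (+-identityʳ s)) s+0≡d = contradiction eq ¬pal
      mismatch s (suc k) s+k≡d eq
        with segment u i (suc (s + m)) ≟ʷ reverse (segment u (k + i) (suc (s + m)))
      ... | no ≢    = s , k , s+k≡d , eq , ≢
      ... | yes eq′ = mismatch (suc s) k (trans (sym (+-suc s k)) s+k≡d) eq′

    -- q is the longest common prefix of the return word and its reversal, and g = q a: the rest of the
    -- return word runs from the end of g back to {q , q̃} without using g again.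
    module _ {s k : ℕ} (s+1+k≡d : s + suc k ≡ d)
             (match : segment u i (s + m) ≡ reverse (segment u (suc k + i) (s + m)))
             (≢-next : segment u i (suc (s + m)) ≢ reverse (segment u (k + i) (suc (s + m)))) where

      private
        r = s + m

        edge-at : ℕ → List A
        edge-at t = segment u (t + i) (suc r)

        g = edge-at 0

        1+s+k≡d : suc s + k ≡ d
        1+s+k≡d = trans (sym (+-suc s k)) s+1+k≡d

        -- `g` begins with the returned palindrome, which does not occur strictly between its two
        -- occurrences.
        ≢-g : ∀ {t} → 0 < t → t ≤ k → edge-at t ≢ g
        ≢-g {t} 0<t t≤k eq = between 0<t (≤-trans (s≤s t≤k) (subst (suc k ≤_) s+1+k≡d (m≤n+m (suc k) s)))
          (applyUpTo-cong⁺ m λ l<m → segment-≡⁻ {j = i} (suc r) eq (m<n⇒m<1+n (<-≤-trans l<m (m≤n+m m s))))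

        -- `reverse g` ends with the returned palindrome, starting `suc s` places in. For `t < k`
        -- this occurrence comes too early, and `t = k` is the mismatch itself.
        ≢-reverse-g : ∀ {t} → t ≤ k → edge-at t ≢ reverse g
        ≢-reverse-g {t} t≤k eq with m≤n⇒m<n∨m≡n t≤k
        ... | inj₂ refl = ≢-next (reverse-flip eq)
        ... | inj₁ t<k  = between {suc s + t} z<s (subst (suc s + t <_) 1+s+k≡d (+-monoʳ-< (suc s) t<k))
                            (applyUpTo-cong⁺ m λ {l} l<m → same l (m ∸ suc l) (m+[n∸m]≡n l<m))
          where
          same : ∀ l b → suc l + b ≡ m → u (suc s + t + i + l) ≡ u (i + l)
          same l b eq′ = begin
            u (suc s + t + i + l)     ≡⟨ cong u (solve 4 (λ s t i l → s :+ t :+ i :+ l := t :+ i :+ (s :+ l)) refl (suc s) t i l) ⟩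
            u (t + i + (suc s + l))   ≡⟨ segment-mirror⁻ (suc r) eq (suc s + l) b (cong suc shift) ⟩
            u (i + b)                 ≡⟨ segment-mirror⁻ m pal l b eq′ ⟨
            u (i + l)                 ∎
            where
            open ≡-Reasoning
            open +-*-Solver
            shift : suc s + l + b ≡ s + m
            shift = trans (solve 3 (λ s l b → con 1 :+ s :+ l :+ b := s :+ (con 1 :+ l :+ b)) refl s l b)
                          (cong (s +_) eq′)

        Avoiding : List A → Set
        Avoiding f = Good r f × f ≢ g × f ≢ reverse g

        end = segment u (suc k + i) r

        end≃q : end ≃ segment u i r
        end≃q = inj₂ (reverse-flip match)

        good : ∀ t → ¬ Palindrome (edge-at t) → Good r (edge-at t)
        good t ¬pal = segment-factor (t + i) (suc r) , ¬pal , length-segment (t + i) (suc r)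

        g-good : Good r g
        g-good = good 0 (≢-reverse-g z≤n)

        reduced : ∀ t t′ → suc t + t′ ≡ suc k → Reduced Avoiding (segment u (suc t + i) r) end
        reduced t zero    eq = inj₁ (inj₁ (cong (λ x → segment u (x + i) r) (trans (sym (+-identityʳ (suc t))) eq)))
        reduced t (suc t′) eq = reduce
          (λ ¬pal → good (suc t) ¬pal , ≢-g z<s 1+t≤k , ≢-reverse-g 1+t≤k)
          (segment-source (suc t + i) r) (segment-target (suc t + i) r)
          (reduced (suc t) t′ eq′)
          where
          eq′ : suc (suc t) + t′ ≡ suc k
          eq′ = trans (sym (+-suc (suc t) t′)) eq
          1+t≤k : suc t ≤ k
          1+t≤k = subst (suc t ≤_) (suc-injective eq′) (m≤m+n (suc t) t′)

      return⇒cyclic : ∃ (CyclicFactor u)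
      return⇒cyclic with reduced 0 k refl
      ... | inj₁ ≃end = closedTrail⇒cyclic r (single g-good)
        (_ , _ , segment-target i r , segment-source i r , ≃-trans ≃end end≃q)
      -- `Avoiding` survives the reduction, so the first remaining edge is not `reverse g` and `g`
      -- can be put in front without turning back.
      ... | inj₂ (f , h , tr , (s′ , src , ≃s′) , (t , tgt , t≃end)) = closedTrail⇒cyclic r
        (g-good ∷⟨ (_ , s′ , segment-target i r , src , ≃s′) , proj₂ (proj₂ (Trail-head tr)) ⟩ Trail-map proj₁ tr)
        (t , _ , tgt , segment-source i r , ≃-trans t≃end end≃q)

    nonPalindromicReturn⇒cyclic : ∃ (CyclicFactor u)
    nonPalindromicReturn⇒cyclic with mismatch 0 d refl (trans pal (cong reverse (sym again)))
    ... | s , k , eq , match , ≢-next = return⇒cyclic eq match ≢-next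

  -- From positive defect to a non-palindromic complete return word

  module _ (i : ℕ) where

    private
      Within : ℕ → List A → Set
      Within n p = ∃₂ λ s l → s + l ≤ n × p ≡ segment u (s + i) l

      Palindromes : ℕ → Set
      Palindromes n = ∃[ ps ] (Unique ps × length ps ≡ suc n × All (λ p → Palindrome p × Within n p) ps)

      -- s is the start of the longest palindromic suffix, of length l.
      next : ∀ k s l → s + l ≡ suc k → Palindrome (segment u (s + i) l) →
             (∀ {t} → t < s → ¬ Palindrome (segment u (t + i) (suc k ∸ t))) →
             Palindromes k → NonPalindromicReturn ⊎ Palindromes (suc k)
      next k s l s+l≡1+k pal below (ps , un , len , pals)
        with greatest (λ t → segment u (t + i) l ≟ʷ segment u (s + i) l) s
      ... | inj₁ (t , t<s , eq , last) = inj₁ record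
        { i       = t + i
        ; d       = s ∸ t
        ; m       = l
        ; 0<d     = m<n⇒0<n∸m t<s
        ; pal     = subst Palindrome (sym eq) pal
        ; again   = trans (cong (λ x → segment u x l) end) (sym eq)
        ; between = λ {x} 0<x x<d eq′ → last {x + t} (m<n+m t 0<x)
            (subst (x + t <_) (m∸n+n≡m (<⇒≤ t<s)) (+-monoˡ-< t x<d))
            (trans (cong (λ y → segment u y l) (+-assoc x t i)) (trans eq′ eq))
        -- This return word is a suffix starting before the longest palindromic one.
        ; ¬pal    = subst (λ n → ¬ Palindrome (segment u (t + i) n)) total (below t<s)
        }
        where
        end : s ∸ t + (t + i) ≡ s + i
        end = trans (sym (+-assoc (s ∸ t) t i)) (cong (_+ i) (m∸n+n≡m (<⇒≤ t<s)))
        total : suc k ∸ t ≡ s ∸ t + l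
        total = trans (cong (_∸ t) (sym s+l≡1+k)) (+-∸-comm l (<⇒≤ t<s))
      ... | inj₂ none = inj₂ (p ∷ ps , All.tabulate new ∷ un , cong suc len ,
                              (pal , s , l , ≤-reflexive s+l≡1+k , refl) ∷ All.map weaken pals)
        where
        p = segment u (s + i) l
        weaken : ∀ {q} → Palindrome q × Within k q → Palindrome q × Within (suc k) q
        weaken (pal , s , l , s+l≤k , eq) = pal , s , l , m≤n⇒m≤1+n s+l≤k , eq
        new : ∀ {q} → q ∈ ps → p ≢ q
        new q∈ refl with All.lookup pals q∈
        ... | _ , s′ , l′ , s′+l′≤k , eq
          with trans (sym (length-segment (s + i) l)) (trans (cong length eq) (length-segment (s′ + i) l′))
        -- An equal word among the earlier palindromes has the same length and ends within the first
        -- `k` letters, so it starts before `s`.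
        ...   | refl = none (+-cancelʳ-< l s′ s (≤-<-trans s′+l′≤k (≤-reflexive (sym s+l≡1+k)))) (sym eq)

      -- Each further letter contributes one new palindrome, the longest palindromic suffix, unless
      -- that suffix has occurred before; its last earlier occurrence then starts a non-palindromic
      -- return word.
      palindromes : ∀ n → NonPalindromicReturn ⊎ Palindromes n
      palindromes zero = inj₂ ([ [] ] , [] ∷ [] , refl , (refl , 0 , 0 , z≤n , refl) ∷ [])
      palindromes (suc k) with palindromes k
      ... | inj₁ ret = inj₁ ret
      ... | inj₂ pals with least (λ s → palindrome? _≟_ (segment u (s + i) (suc k ∸ s))) (suc k)
                             (subst (λ n → Palindrome (segment u (suc k + i) n)) (sym (n∸n≡0 (suc k))) refl)
      ...   | s , s≤ , pal , below = next k s (suc k ∸ s) (m+[n∸m]≡n s≤) pal below pals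

      within∈ : ∀ {n p} → Palindrome p → Within n p → p ∈ palindromicFactors _≟_ (segment u i n)
      within∈ {n} pal (s , l , s+l≤n , refl) = ∈-deduplicate⁺ _≟ʷ_ (∈-filter⁺ (palindrome? _≟_)
        (subst (λ w → segment u (s + i) l ∈ concatMap inits (tails w)) (sym split)
          (infix∈ (segment u i s) (segment u (s + i) l) suffix)) pal)
        where
        rest = n ∸ (s + l)
        suffix = applyUpTo (λ k → u (i + (s + (l + k)))) rest
        split : segment u i n ≡ segment u i s ++ segment u (s + i) l ++ suffix
        split = begin
          segment u i n
            ≡⟨ cong (segment u i) (trans (sym (+-assoc s l rest)) (m+[n∸m]≡n s+l≤n)) ⟨
          segment u i (s + (l + rest))
            ≡⟨ applyUpTo-+ _ s (l + rest) ⟩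
          segment u i s ++ applyUpTo (λ k → u (i + (s + k))) (l + rest)
            ≡⟨ cong (segment u i s ++_) (applyUpTo-+ _ l rest) ⟩
          segment u i s ++ applyUpTo (λ k → u (i + (s + k))) l ++ suffix
            ≡⟨ cong (λ x → segment u i s ++ x ++ suffix) (applyUpTo-cong⁺ l λ {k} _ → cong u (shift k)) ⟩
          segment u i s ++ segment u (s + i) l ++ suffix
            ∎
          where
          open ≡-Reasoning
          shift : ∀ k → i + (s + k) ≡ s + i + k
          shift k = trans (sym (+-assoc i s k)) (cong (_+ k) (+-comm i s))

    defect>0⇒return : ∀ n → 0 < defect _≟_ (segment u i n) → NonPalindromicReturn
    defect>0⇒return n 0<D with palindromes n
    ... | inj₁ ret = ret
    ... | inj₂ (ps , un , len , pals) = contradiction 0<D (≤⇒≯ (≤-reflexive (m≤n⇒m∸n≡0 enough)))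
      where
      ps⊆ : ps ⊆ palindromicFactors _≟_ (segment u i n)
      ps⊆ p∈ with All.lookup pals p∈
      ... | pal , within = within∈ pal within
      enough : suc (length (segment u i n)) ≤ length (palindromicFactors _≟_ (segment u i n))
      enough = subst (_≤ length (palindromicFactors _≟_ (segment u i n)))
        (trans len (cong suc (sym (length-segment i n)))) (Unique-⊆⇒length≤ un ps⊆)

  𝔻>0⇒return : 0 <∞ 𝔻 u _≟_ → NonPalindromicReturn
  𝔻>0⇒return ((w , i , occ) , 0<D) = defect>0⇒return i (length w) (subst (λ x → 0 < defect _≟_ x) (sym occ) 0<D)

  -- Letters with non-palindromic complete return words

  LetterReturn : Set
  LetterReturn = ∃[ a ] ∃[ v ] (CompleteReturnWord u [ a ] v × ¬ Palindrome v)

  -- The reversal of the prefix of length `suc (N + j)` occurs somewhere, and the letter from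
  -- position `j` stands `N` places into that occurrence.
  recurrent : ∀ {a j} → u j ≡ a → ∀ N → ∃[ e ] u (e + N) ≡ a
  recurrent {a} {j} uj≡a N with closed _ (segment-factor 0 (suc (N + j)))
  ... | i , occ = i , trans (segment-mirror⁻ {i} {0} (suc (N + j)) eq N j refl) uj≡a
    where
    eq : segment u i (suc (N + j)) ≡ reverse (segment u 0 (suc (N + j)))
    eq = subst (λ n → segment u i n ≡ reverse (segment u 0 (suc (N + j))))
               (trans (length-reverse (segment u 0 (suc (N + j)))) (length-segment 0 (suc (N + j)))) occ

  letter-occurs⁺ : ∀ {a i} → u i ≡ a → OccursAt u [ a ] i
  letter-occurs⁺ {i = i} eq = cong [_] (trans (cong u (+-identityʳ i)) eq)

  letter-occurs⁻ : ∀ {a i} → OccursAt u [ a ] i → u i ≡ a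
  letter-occurs⁻ {i = i} eq = trans (cong u (sym (+-identityʳ i))) (∷-injectiveˡ eq)

  letter-return : ∀ {a} i d → 0 < d → u i ≡ a → u (d + i) ≡ a →
                  (∀ {t} → 0 < t → t < d → u (t + i) ≢ a) →
                  LetterReturn ⊎ (∀ k l → k + l ≡ d → u (k + i) ≡ u (l + i))
  letter-return {a} i d 0<d at-i at-d between with palindrome? _≟_ (segment u i (suc d))
  ... | yes pal = inj₂ λ k l k+l≡d → trans (cong u (+-comm k i))
                    (trans (segment-mirror⁻ (suc d) pal k l (cong suc k+l≡d)) (cong u (+-comm i l)))
  ... | no ¬pal = inj₁ (a , segment u i (suc d) ,
    (i , d + i , (m<n+m i 0<d , letter-occurs⁺ at-i , letter-occurs⁺ at-d , between′) ,
     cong (segment u i) (sym (trans (cong (_∸ i) (+-comm (d + i) 1)) (m+n∸n≡m (suc d) i)))) , ¬pal)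
    where
    between′ : ∀ k → i < k → k < d + i → ¬ OccursAt u [ a ] k
    between′ k i<k k<d+i occ = between {k ∸ i} (m<n⇒0<n∸m i<k)
      (+-cancelʳ-< i (k ∸ i) d (subst (_< d + i) (sym k≡) k<d+i))
      (trans (cong u k≡) (letter-occurs⁻ occ))
      where
      k≡ : k ∸ i + i ≡ k
      k≡ = m∸n+n≡m (<⇒≤ i<k)

  -- Seen from position i, the letter a is next reached from its neighbour b.
  Gate : A → ℕ → A → Set
  Gate a i b = ∃[ x ] (u (x + i) ≡ b × u (suc x + i) ≡ a × (∀ {y} → y ≤ x → u (y + i) ≢ a))

  Gate-unique : ∀ {a i b b′} → Gate a i b → Gate a i b′ → b ≡ b′
  Gate-unique (x , at-x , a-at , before) (x′ , at-x′ , a-at′ , before′) with <-cmp x x′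
  ... | tri< x<x′ _ _ = contradiction a-at (before′ x<x′)
  ... | tri≈ _ refl _ = trans (sym at-x) at-x′
  ... | tri> _ _ x′<x = contradiction a-at′ (before x′<x)

  pair : ∀ {b c} → Graph.Adjacent (Θ u []) b c → ∃[ t ] (u t ≡ b × u (suc t) ≡ c)
  pair adj with factor adj
    where
    factor : ∀ {b c} → Graph.Adjacent (Θ u []) b c → Factor u (b ∷ c ∷ [])
    factor (fwd (f , _)) = f
    factor (bwd (f , _)) = closed _ f
  ... | t , occ = t , trans (cong u (sym (+-identityʳ t))) (∷-injectiveˡ occ) ,
                  trans (cong u (sym (+-comm t 1))) (∷-injectiveˡ (∷-injectiveʳ occ))

  module _ {a : A} {j : ℕ} (uj≡a : u j ≡ a) where

    gate : ∀ {i} → u i ≢ a → ∃[ b ] Gate a i b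
    gate {i} ui≢a with recurrent uj≡a i
    ... | e , at-e with least (λ t → u (t + i) ≟ a) e at-e
    ...   | zero  , _ , at-0 , _     = contradiction at-0 ui≢a
    ...   | suc x , _ , at-x , below = u (x + i) , x , refl , at-x , λ y≤x → below (s≤s y≤x)

    -- If the return word to c leaves a through b but the next return to a enters through b′ ≠ b, then
    -- these two return words cannot both be palindromes.
    consecutive : ∀ {c i e b b′} → c ≢ a → 0 < e → u i ≡ c → u (e + i) ≡ c →
                  (∀ {t} → 0 < t → t < e → u (t + i) ≢ c) →
                  Gate a i b → Gate a (e + i) b′ → LetterReturn ⊎ b ≡ b′
    consecutive {c} {i} {e} {b} {b′} c≢a 0<e at-i at-e none
      (x , at-x , a-at , before) gate′@(x′ , at-x′ , a-at′ , before′)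
      with <-cmp (suc x) e
    ... | tri≈ _ refl _ = contradiction (trans (sym at-e) a-at) c≢a
    -- No `a` separates the two occurrences of `c`, so both look towards the same `a`.
    ... | tri> _ _ (s<s e≤x) = inj₂ (Gate-unique
      (x ∸ e , trans (cong u (shift 0)) at-x , trans (cong u (shift 1)) a-at ,
       λ {y} y≤ a-at-y → before {y + e} (subst (y + e ≤_) (m∸n+n≡m e≤x) (+-monoˡ-≤ e y≤))
         (trans (cong u (+-assoc y e i)) a-at-y)) gate′)
      where
      shift : ∀ z → z + (x ∸ e) + (e + i) ≡ z + x + i
      shift z = trans (sym (+-assoc (z + (x ∸ e)) e i))
        (cong (_+ i) (trans (+-assoc z (x ∸ e) e) (cong (z +_) (m∸n+n≡m e≤x))))
    ... | tri< 1+x<e _ _ with letter-return i e 0<e at-i at-e none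
    ...   | inj₁ ret′   = inj₁ ret′
    ...   | inj₂ mirror = Sum.map₂ enters-from (letter-return (y + i) D z<s a-at-y a-at-D between)
      where
      -- Position `y + i` mirrors the first `a` after the first `c`, so it is the last `a` before
      -- the second `c`; the next `a` comes `D` places later.
      y = e ∸ suc x
      D = suc x′ + suc x

      1+x+y≡e : suc x + y ≡ e
      1+x+y≡e = m+[n∸m]≡n (<⇒≤ 1+x<e)

      past-e : ∀ z → z + suc x + (y + i) ≡ z + (e + i)
      past-e z = trans (+-assoc z (suc x) (y + i)) (cong (z +_) (trans (sym (+-assoc (suc x) y i)) (cong (_+ i) 1+x+y≡e)))

      a-at-y : u (y + i) ≡ a
      a-at-y = trans (sym (mirror (suc x) y 1+x+y≡e)) a-at

      a-at-D : u (D + (y + i)) ≡ a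
      a-at-D = trans (cong u (past-e (suc x′))) a-at′

      between : ∀ {t} → 0 < t → t < D → u (t + (y + i)) ≢ a
      between {t} 0<t t<D a-at-t with ≤-total t (suc x)
      ... | inj₁ t≤ = before (≤-pred (∸-monoʳ-< 0<t t≤))
        (trans (mirror (suc x ∸ t) (t + y) e≡) (trans (cong u (+-assoc t y i)) a-at-t))
        where
        e≡ : suc x ∸ t + (t + y) ≡ e
        e≡ = trans (sym (+-assoc (suc x ∸ t) t y)) (trans (cong (_+ y) (m∸n+n≡m t≤)) 1+x+y≡e)
      ... | inj₂ ≤t = before′ (≤-pred (+-cancelʳ-< (suc x) (t ∸ suc x) (suc x′) (subst (_< D) (sym t≡) t<D)))
        (trans (cong u (trans (sym (past-e (t ∸ suc x))) (cong (_+ (y + i)) t≡))) a-at-t)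
        where
        t≡ : t ∸ suc x + suc x ≡ t
        t≡ = m∸n+n≡m ≤t

      enters-from : (∀ k l → k + l ≡ D → u (k + (y + i)) ≡ u (l + (y + i))) → b ≡ b′
      -- The return word to `c` carries the letter before its first `a` to the letter after its last
      -- `a`; the return word to `a` carries that to the letter before the next `a`.
      enters-from mirror′ = begin
        b                          ≡⟨ at-x ⟨
        u (x + i)                  ≡⟨ mirror x (suc y) (trans (+-suc x y) 1+x+y≡e) ⟩
        u (1 + (y + i))            ≡⟨ mirror′ 1 (x′ + suc x) refl ⟩
        u (x′ + suc x + (y + i))   ≡⟨ cong u (past-e x′) ⟩
        u (x′ + (e + i))           ≡⟨ at-x′ ⟩
        b′                         ∎
        where open ≡-Reasoning

    -- Chains `consecutive` along the occurrences of `c` between the two positions; `bound` makes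
    -- the recursion structural.
    same-letter-≤ : ∀ {c b b′} → c ≢ a → ∀ bound e i → e ≤ bound → u i ≡ c → u (e + i) ≡ c →
                    Gate a i b → Gate a (e + i) b′ → LetterReturn ⊎ b ≡ b′
    same-letter-≤ c≢a _ zero i _ _ _ g g′ = inj₂ (Gate-unique g g′)
    same-letter-≤ {c} {b} {b′} c≢a (suc bound) (suc e) i (s≤s e≤) at-i at-e g g′
      with least (λ t → u (suc t + i) ≟ c) e at-e
    ... | t , t≤e , at-t , below with gate {suc t + i} (λ a-at → c≢a (trans (sym at-t) a-at))
    ...   | b″ , g″ with consecutive c≢a z<s at-i at-t (λ { {suc k} _ (s<s k<t) → below k<t }) g g″
    ...     | inj₁ ret′ = inj₁ ret′
    ...     | inj₂ refl = same-letter-≤ c≢a bound (e ∸ t) (suc t + i) (≤-trans (m∸n≤m e t) e≤) at-t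
      (trans (cong u shift) at-e) g″ (subst (λ p → Gate a p b′) (sym shift) g′)
      where
      shift : e ∸ t + (suc t + i) ≡ suc e + i
      shift = trans (+-suc (e ∸ t) (t + i))
        (cong suc (trans (sym (+-assoc (e ∸ t) t i)) (cong (_+ i) (m∸n+n≡m t≤e))))

    same-letter : ∀ {c b b′ i k} → c ≢ a → u i ≡ c → u k ≡ c → Gate a i b → Gate a k b′ → LetterReturn ⊎ b ≡ b′
    same-letter {c} {b} {b′} {i} {k} c≢a at-i at-k g g′ with ≤-total i k
    ... | inj₁ i≤k = same-letter-≤ c≢a (k ∸ i) (k ∸ i) i ≤-refl at-i
      (trans (cong u k≡) at-k) g (subst (λ p → Gate a p b′) (sym k≡) g′)
      where
      k≡ : k ∸ i + i ≡ k
      k≡ = m∸n+n≡m i≤k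
    ... | inj₂ k≤i = Sum.map₂ sym (same-letter-≤ c≢a (i ∸ k) (i ∸ k) k ≤-refl at-k
      (trans (cong u i≡) at-i) g′ (subst (λ p → Gate a p b) (sym i≡) g))
      where
      i≡ : i ∸ k + k ≡ i
      i≡ = m∸n+n≡m k≤i

    -- Everything reached from y without passing through a is seen from a behind the gate y.
    step : ∀ {y c c′ t} → c ≢ a → c′ ≢ a → Graph.Adjacent (Θ u []) c c′ → u t ≡ c → Gate a t y →
           LetterReturn ⊎ (∃[ t′ ] (u t′ ≡ c′ × Gate a t′ y))
    step c≢a c′≢a adj at-t g with pair adj
    ... | s , at-s , at-1+s with gate {s} (λ a-at → c≢a (trans (sym at-s) a-at))
    ...   | b , g′ with same-letter c≢a at-t at-s g g′ | g′
    ...     | inj₁ ret′ | _ = inj₁ ret′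
    -- The gate is not at `s` itself, because the next letter `c′` differs from `a`; so one place to
    -- the right it is still the same gate.
    ...     | inj₂ refl | zero  , _ , a-at , _ = contradiction (trans (sym at-1+s) a-at) c′≢a
    ...     | inj₂ refl | suc x , at-x , a-at , before = inj₂ (suc s , at-1+s ,
      x , trans (cong u (+-suc x s)) at-x , trans (cong u (+-suc (suc x) s)) a-at ,
      λ {y} y≤x a-at-y → before (s≤s y≤x) (trans (cong u (sym (+-suc y s))) a-at-y))

    -- The last letter of the cycle is somewhere followed by `a`, where it is its own gate; by
    -- `same-letter` it must then be `y`.
    thread : ∀ {y c t} cs → All (a ≢_) (c ∷ cs) → Linked (Graph.Adjacent (Θ u [])) (c ∷ (cs ∷ʳ a)) →
             u t ≡ c → Gate a t y → LetterReturn ⊎ y ∈ c ∷ cs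
    thread [] (a≢c ∷ []) (adj ∷ [-]) at-t g with pair adj
    ... | s , at-s , a-at with same-letter (≢-sym a≢c) at-t at-s g
                                 (0 , at-s , a-at , λ { z≤n a-at-s → a≢c (trans (sym a-at-s) at-s) })
    ...   | inj₁ ret′ = inj₁ ret′
    ...   | inj₂ y≡c  = inj₂ (here y≡c)
    thread (c′ ∷ cs) (a≢c ∷ a≢) (adj ∷ linked) at-t g with step (≢-sym a≢c) (≢-sym (All.head a≢)) adj at-t g
    ... | inj₁ ret′ = inj₁ ret′
    ... | inj₂ (t′ , at-t′ , g′) with thread cs a≢ linked at-t′ g′
    ...   | inj₁ ret′ = inj₁ ret′
    ...   | inj₂ y∈   = inj₂ (there y∈)

  Θ[]-cycle⇒nonPalindromicReturn : ContainsCycle (Θ u []) → LetterReturn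
  Θ[]-cycle⇒nonPalindromicReturn (_ , _ ∷ [] , s≤s () , _)
  -- The first edge, reversed, puts `y` directly before an `a`. Carried around the cycle, this gate
  -- would be a later vertex, against distinctness.
  Θ[]-cycle⇒nonPalindromicReturn (a , y ∷ c ∷ cs , _ , (a≢y ∷ a≢cs) ∷ y∉ ∷ _ , _ , adj ∷ adj′ ∷ linked)
    with pair (symmetric _ adj)
  ... | s , at-s , a-at with step a-at (≢-sym a≢y) (≢-sym (All.head a≢cs)) adj′ at-s
                               (0 , at-s , a-at , λ { z≤n a-at-s → a≢y (trans (sym a-at-s) at-s) })
  ...   | inj₁ ret′ = ret′
  ...   | inj₂ (t , at-t , g) with thread a-at cs a≢cs linked at-t g
  ...     | inj₁ ret′ = ret′
  ...     | inj₂ y∈   = contradiction refl (All.lookup y∉ y∈)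

theorem26 : {A : Set} (_≟_ : DecidableEquality A) (u : ℕ → A) →
    ClosedUnderReversal u →
    0 <∞ 𝔻 u _≟_ →
    ( (∃[ q ] (Factor u q × ¬ Palindrome q × ContainsCycle (Γ u q)))
    ⊎ (∃[ q ] (Factor u q × Palindrome q × ContainsCycle (Θ u q))) )
    × ( (CyclicFactor u [] × (∀ q → CyclicFactor u q → q ≡ [])) →
    ∃[ a ] ∃[ v ] (CompleteReturnWord u [ a ] v × ¬ Palindrome v) )
theorem26 _≟_ u closed 0<𝔻 = cyclic , λ where
    (inj₁ (_ , ¬pal , _) , _)  → contradiction refl ¬pal
    (inj₂ (_ , _ , cycle) , _) → Θ[]-cycle⇒nonPalindromicReturn cycle
  where
  open Rauzy _≟_ u closed
  cyclic : (∃[ q ] (Factor u q × ¬ Palindrome q × ContainsCycle (Γ u q)))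
         ⊎ (∃[ q ] (Factor u q × Palindrome q × ContainsCycle (Θ u q)))
  cyclic with nonPalindromicReturn⇒cyclic (𝔻>0⇒return 0<𝔻)
  ... | q , inj₁ qΓ = inj₁ (q , qΓ)
  ... | q , inj₂ qΘ = inj₂ (q , qΘ)
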